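{- Let $\mathcal{H}=\mathrm{L}(l,h,w,y)$ be a tight minimum distance diagram of area $N$, where $N\neq3t^2$ for every integer $t$. Then, for an integer $m\ge1$, the extension $m\mathcal{H}=\mathrm{L}(ml,mh,mw,my)$ is tight if and only if \[1\leq m\leq\left\lfloor\frac{1}{\lceil\sqrt{3N}\rceil-\sqrt{3N}}\right\rfloor.\]
   Context: For integers $0\le w<l$, $0\le y<h$, the L-shape $\mathrm{L}(l,h,w,y)=\{(i,j)\in\mathbb{Z}^2:0\le i<l,0\le j<h\}\setminus\{(i,j):l-w\le i<l,h-y\le j<h\}$ has area $lh-wy$ and diameter $l+h-\min\{w,y\}-2$. A minimum distance diagram is such an L-shape that is the image of a minimum distance diagram map $\psi:\mathrm{G}\to\mathbb{N}^2$ of a $2$--Cayley digraph $\mathrm{Cay}(\mathrm{G},\{a,b\})$ ($\mathrm{G}$ finite Abelian generated by nonzero $a,b$; $\psi(\eta)=(i,j)$ with $ia+jb=\eta$, $i+j$ minimal, image closed under coordinatewise smaller vectors in $\mathbb{N}^2$). With $\mathrm{lb}(N)=\lceil\sqrt{3N}\rceil-2$, an L-shape of area $N$ is tight if its diameter equals $\mathrm{lb}(N)$. -}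

module Defs where

open import Level using (0ℓ)
open import Data.Nat using (ℕ; zero; suc; _+_; _*_; _∸_; _≤_; _<_; _⊓_; _≤ᵇ_)
open import Data.Bool using (if_then_else_)
open import Data.Product using (Σ; ∃; _×_; _,_; proj₁; proj₂)
open import Relation.Nullary using (¬_)
open import Relation.Binary.PropositionalEquality using (_≡_)
open import Function.Bundles using (_⇔_)
open import Algebra.Bundles using (AbelianGroup)
import Algebra.Definitions.RawMonoid as RM

InL : ℕ → ℕ → ℕ → ℕ → ℕ → ℕ → Set
InL l h w y i j = (i < l × j < h) × ¬ ((l ∸ w ≤ i) × (h ∸ y ≤ j))

area : ℕ → ℕ → ℕ → ℕ → ℕ
area l h w y = l * h ∸ w * y

diam : ℕ → ℕ → ℕ → ℕ → ℕ
diam l h w y = (l + h) ∸ (w ⊓ y) ∸ 2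

ceilSqrt : ℕ → ℕ
ceilSqrt n = go (suc n) 0
  where
  go : ℕ → ℕ → ℕ
  go zero    c = c
  go (suc k) c = if n ≤ᵇ c * c then c else go k (suc c)

lb : ℕ → ℕ
lb N = ceilSqrt (3 * N) ∸ 2

Tight : ℕ → ℕ → ℕ → ℕ → Set
Tight l h w y = diam l h w y ≡ lb (area l h w y)

module _ (G : AbelianGroup 0ℓ 0ℓ) where
  open AbelianGroup G
  open RM rawMonoid using () renaming (_×_ to _·_)

  record IsMDDMap (a b : Carrier) (ψ : Carrier → ℕ × ℕ) : Set where
    field
      ψ-cong     : ∀ {η η′} → η ≈ η′ → ψ η ≡ ψ η′
      ψ-repr     : ∀ η → (proj₁ (ψ η) · a) ∙ (proj₂ (ψ η) · b) ≈ η
      ψ-minimal  : ∀ η i j → (i · a) ∙ (j · b) ≈ η →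
                   proj₁ (ψ η) + proj₂ (ψ η) ≤ i + j
      ψ-downward : ∀ η i j → i ≤ proj₁ (ψ η) → j ≤ proj₂ (ψ η) →
                   ∃ λ η′ → ψ η′ ≡ (i , j)

-- L(l,h,w,y) is a minimum distance diagram: it is the image of a
-- minimum distance diagram map of some Cay(G,{a,b}), G Abelian,
-- a, b nonzero (G is then automatically finite and generated by a, b,
-- since ψ is injective with finite image and every η = ia + jb).
IsMDD : ℕ → ℕ → ℕ → ℕ → Set₁
IsMDD l h w y =
  Σ (AbelianGroup 0ℓ 0ℓ) λ G →
  let open AbelianGroup G in
  Σ Carrier λ a → Σ Carrier λ b → Σ (Carrier → ℕ × ℕ) λ ψ →
    ¬ (a ≈ ε) × ¬ (b ≈ ε) × IsMDDMap G a b ψ ×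
    (∀ i j → InL l h w y i j ⇔ (∃ λ η → ψ η ≡ (i , j)))

-- m ≤ ⌊ 1 / (⌈√x⌉ − √x) ⌋, for x not a perfect square (so ⌈√x⌉ > √x).
-- With c = ⌈√x⌉ this is  m(c − √x) ≤ 1  ⇔  mc − 1 ≤ m√x
-- ⇔ (mc − 1)² ≤ m² x   (for m ≥ 1, x ≥ 1, so mc ≥ 1).
LeFloorInvGap : ℕ → ℕ → Set
LeFloorInvGap x m = (m * ceilSqrt x ∸ 1) * (m * ceilSqrt x ∸ 1) ≤ (m * m) * x

{-# OPTIONS --safe #-}

-- Put x = 3N and c = ⌈√x⌉.  Tightness of H says l + h − min(w,y) = c, and the
-- extension by m scales this quantity by m and x by m², so it is tight iff
-- ⌈√(m²x)⌉ = mc, i.e. iff (mc − 1)² < m²x.  This differs from the claimed bound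
-- only when (mc − 1)² = m²x; but then m divides both mc and (mc − 1)², hence
-- m = 1 and (c − 1)² = x, against the minimality of c.
module Submission where

open import Defs
open import Data.Nat using (ℕ; zero; suc; _+_; _*_; _∸_; _⊓_; _≤_; _<_; _≤ᵇ_; z≤n; s≤s; s≤s⁻¹; z<s)
open import Data.Nat.Properties
open import Data.Nat.Divisibility using (_∣_; ∣m+n∣m⇒∣n; m∣m*n; ∣n⇒∣m*n; ∣1⇒≡1)
open import Data.Bool using (true; false; if_then_else_; T)
open import Data.Unit using (tt)
open import Data.Product using (_×_; _,_; proj₁; proj₂)
open import Relation.Binary.PropositionalEquality
open import Function.Bundles using (_⇔_; mk⇔; module Equivalence)

-- The loop of ceilSqrt is local to its where-block, so it is recovered here by
-- unification: abstracting the literals in an unfolded call leaves a pattern.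
mutual
  search : ℕ → ℕ → ℕ → ℕ
  search = _

  ceilSqrt-unfold : ∀ p → ceilSqrt (suc (suc p)) ≡
    (if suc (suc p) ≤ᵇ 4 then 2 else search (suc (suc p)) p 3)
  ceilSqrt-unfold p with suc (suc p) | 3
  ... | _ | _ = refl

IsCeilSqrt : ℕ → ℕ → Set
IsCeilSqrt n r = n ≤ r * r × (∀ d → d < r → d * d < n)

-- Induction on the fuel `k`. The first hypothesis is the loop invariant that every candidate before
-- `c` has failed; the second says that the fuel reaches a valid candidate, so at `k = 0` the
-- current `c` is itself valid.
search-isCeilSqrt : ∀ n k c → (∀ d → d < c → d * d < n) →
  n ≤ (k + c) * (k + c) → IsCeilSqrt n (search n k c)
search-isCeilSqrt n zero    c below n≤ = n≤ , below
search-isCeilSqrt n (suc k) c below n≤ with n ≤ᵇ c * c in eq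
... | true  = ≤ᵇ⇒≤ n (c * c) (subst T (sym eq) tt) , below
... | false = search-isCeilSqrt n k (suc c) below′
                (subst (λ e → n ≤ e * e) (sym (+-suc k c)) n≤)
  where
  c²<n : c * c < n
  c²<n = ≰⇒> λ n≤c² → subst T eq (≤⇒≤ᵇ n≤c²)

  below′ : ∀ d → d < suc c → d * d < n
  below′ d d<1+c = ≤-<-trans (*-mono-≤ (s≤s⁻¹ d<1+c) (s≤s⁻¹ d<1+c)) c²<n

ceilSqrt-isCeilSqrt : ∀ n → IsCeilSqrt n (ceilSqrt n)
ceilSqrt-isCeilSqrt n = search-isCeilSqrt n (suc n) 0 (λ _ ()) n≤
  where
  n≤ : n ≤ (suc n + 0) * (suc n + 0)
  n≤ = ≤-trans (n≤1+n n) (≤-trans (m≤m+n (suc n) 0) (m≤m*n (suc n + 0) (suc n + 0)))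

square<⇒< : ∀ {n r d} → n ≤ r * r → d * d < n → d < r
square<⇒< n≤r² d²<n =
  ≰⇒> λ r≤d → <⇒≱ d²<n (≤-trans n≤r² (*-mono-≤ r≤d r≤d))

IsCeilSqrt-unique : ∀ {n r s} → IsCeilSqrt n r → IsCeilSqrt n s → r ≡ s
IsCeilSqrt-unique (n≤r² , r-min) (n≤s² , s-min) = ≤-antisym
  (≮⇒≥ λ s<r → <⇒≱ (r-min _ s<r) n≤s²)
  (≮⇒≥ λ r<s → <⇒≱ (s-min _ r<s) n≤r²)

1<ceilSqrt : ∀ {n} → 1 < n → 1 < ceilSqrt n
1<ceilSqrt = square<⇒< (proj₁ (ceilSqrt-isCeilSqrt _))

-- From `m ∣ k * suc k = k * k + k` one gets `m ∣ k`, and consecutive integers are coprime.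
∣suc∧∣square⇒≡1 : ∀ {m k} → m ∣ suc k → m ∣ k * k → m ≡ 1
∣suc∧∣square⇒≡1 {m} {k} m∣1+k m∣k² = ∣1⇒≡1 (∣m+n∣m⇒∣n m∣k+1 m∣k)
  where
  m∣k : m ∣ k
  m∣k = ∣m+n∣m⇒∣n (subst (m ∣_) (trans (*-suc k k) (+-comm k (k * k))) (∣n⇒∣m*n k m∣1+k)) m∣k²

  m∣k+1 : m ∣ k + 1
  m∣k+1 = subst (m ∣_) (+-comm 1 k) m∣1+k

[m*c∸1]²≢m²*x : ∀ {m c x} → 0 < m * c → (c ∸ 1) * (c ∸ 1) < x →
  (m * c ∸ 1) * (m * c ∸ 1) ≢ (m * m) * x
[m*c∸1]²≢m²*x {m} {c} {x} 0<mc [c-1]²<x eq = <-irrefl [c-1]²≡x [c-1]²<x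
  where
  m≡1 : m ≡ 1
  m≡1 = ∣suc∧∣square⇒≡1
    -- Since `0 < m * c`, the truncated `m * c ∸ 1` is a true predecessor, so its successor is
    -- `m * c`.
    (subst (m ∣_) (sym (m+[n∸m]≡n 0<mc)) (m∣m*n c))
    (subst (m ∣_) (trans (sym (*-assoc m m x)) (sym eq)) (m∣m*n (m * x)))

  [c-1]²≡x : (c ∸ 1) * (c ∸ 1) ≡ x
  [c-1]²≡x = begin
    (c ∸ 1) * (c ∸ 1)         ≡⟨ cong (λ e → (e ∸ 1) * (e ∸ 1)) (*-identityˡ c) ⟨
    (1 * c ∸ 1) * (1 * c ∸ 1) ≡⟨ subst (λ m → (m * c ∸ 1) * (m * c ∸ 1) ≡ (m * m) * x) m≡1 eq ⟩
    1 * 1 * x                 ≡⟨ *-identityˡ x ⟩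
    x                         ∎
    where open ≡-Reasoning

-- The square of `m * c` always reaches `m * m * x`, so only minimality is in question, and it is
-- decided by the single candidate `m * c ∸ 1`.
ceilSqrt-scale : ∀ x m → 1 < x → 1 ≤ m →
  (m * ceilSqrt x ≡ ceilSqrt ((m * m) * x)) ⇔ LeFloorInvGap x m
ceilSqrt-scale x m 1<x 1≤m = mk⇔ to from
  where
  c = ceilSqrt x

  0<c : 0 < c
  0<c = <-trans z<s (1<ceilSqrt 1<x)

  0<mc : 0 < m * c
  0<mc = *-mono-≤ 1≤m 0<c

  pred< : ∀ {n} → 0 < n → n ∸ 1 < n
  pred< z<s = n<1+n _

  m²x≤[mc]² : (m * m) * x ≤ (m * c) * (m * c)
  m²x≤[mc]² = begin
    (m * m) * x         ≤⟨ *-monoʳ-≤ (m * m) (proj₁ (ceilSqrt-isCeilSqrt x)) ⟩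
    (m * m) * (c * c)   ≡⟨ [m*n]*[o*p]≡[m*o]*[n*p] m m c c ⟩
    (m * c) * (m * c)   ∎
    where open ≤-Reasoning

  to : m * c ≡ ceilSqrt ((m * m) * x) → LeFloorInvGap x m
  to eq = <⇒≤ (proj₂ (ceilSqrt-isCeilSqrt ((m * m) * x)) _
    (subst (m * c ∸ 1 <_) eq (pred< 0<mc)))

  from : LeFloorInvGap x m → m * c ≡ ceilSqrt ((m * m) * x)
  from le = IsCeilSqrt-unique (m²x≤[mc]² , below) (ceilSqrt-isCeilSqrt ((m * m) * x))
    where
    -- `LeFloorInvGap` is a weak inequality while minimality needs a strict one; divisibility
    -- excludes the boundary case.
    [mc-1]²<m²x : (m * c ∸ 1) * (m * c ∸ 1) < (m * m) * x
    [mc-1]²<m²x = ≤∧≢⇒< le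
      ([m*c∸1]²≢m²*x {m} 0<mc (proj₂ (ceilSqrt-isCeilSqrt x) _ (pred< 0<c)))

    below : ∀ d → d < m * c → d * d < (m * m) * x
    below d d<mc = ≤-<-trans (*-mono-≤ d≤ d≤) [mc-1]²<m²x
      where
      d≤ : d ≤ m * c ∸ 1
      d≤ = ∸-monoˡ-≤ 1 d<mc

area-scale : ∀ m l h w y → area (m * l) (m * h) (m * w) (m * y) ≡ (m * m) * area l h w y
area-scale m l h w y = begin
  (m * l) * (m * h) ∸ (m * w) * (m * y)
    ≡⟨ cong₂ _∸_ ([m*n]*[o*p]≡[m*o]*[n*p] m l m h) ([m*n]*[o*p]≡[m*o]*[n*p] m w m y) ⟩
  (m * m) * (l * h) ∸ (m * m) * (w * y)
    ≡⟨ *-distribˡ-∸ (m * m) (l * h) (w * y) ⟨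
  (m * m) * (l * h ∸ w * y) ∎
  where open ≡-Reasoning

diam-scale : ∀ m l h w y →
  diam (m * l) (m * h) (m * w) (m * y) ≡ m * ((l + h) ∸ (w ⊓ y)) ∸ 2
diam-scale m l h w y = cong (_∸ 2) (begin
  (m * l + m * h) ∸ (m * w) ⊓ (m * y)
    ≡⟨ cong₂ _∸_ (*-distribˡ-+ m l h) (*-distribˡ-⊓ m w y) ⟨
  m * (l + h) ∸ m * (w ⊓ y)
    ≡⟨ *-distribˡ-∸ m (l + h) (w ⊓ y) ⟨
  m * ((l + h) ∸ (w ⊓ y)) ∎)
  where open ≡-Reasoning

area>0 : ∀ {l h w y} → w < l → y < h → 0 < area l h w y
area>0 w<l y<h = m<n⇒0<n∸m (*-mono-< w<l y<h)

-- Ensures that the truncated `∸ 2` in `diam` loses nothing and can be cancelled.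
1<l+h∸w⊓y : ∀ {l h w y} → w < l → y < h → 1 < (l + h) ∸ (w ⊓ y)
1<l+h∸w⊓y {l} {h} {w} {y} w<l y<h = m+n≤o⇒m≤o∸n 2 (begin
  2 + (w ⊓ y)   ≤⟨ +-monoʳ-≤ 2 (≤-trans (m⊓n≤m w y) (m≤m+n w y)) ⟩
  2 + (w + y)   ≡⟨ cong suc (+-suc w y) ⟨
  suc w + suc y ≤⟨ +-mono-≤ w<l y<h ⟩
  l + h         ∎)
  where open ≤-Reasoning

theorem5 : (l h w y : ℕ) → w < l → y < h →
    IsMDD l h w y → Tight l h w y →
    (∀ t → area l h w y ≢ 3 * (t * t)) →
    (m : ℕ) → 1 ≤ m →
    (Tight (m * l) (m * h) (m * w) (m * y) ⇔
    (1 ≤ m × LeFloorInvGap (3 * area l h w y) m))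
theorem5 l h w y w<l y<h _ tight _ m 1≤m = mk⇔
  (λ tightₘ → 1≤m , to (∸-cancelʳ-≡ 1<mc 1<cₘ (trans (sym diamₘ) (trans tightₘ lbₘ))))
  (λ (_ , le) → trans diamₘ (trans (cong (_∸ 2) (from le)) (sym lbₘ)))
  where
  x = 3 * area l h w y

  1<x : 1 < x
  1<x = ≤-trans (s≤s (s≤s z≤n)) (*-monoʳ-≤ 3 (area>0 w<l y<h))

  open Equivalence (ceilSqrt-scale x m 1<x 1≤m) using (to; from)

  -- Tightness equates the two sides after `∸ 2`; both are at least 2, so they agree before it.
  s≡c : (l + h) ∸ (w ⊓ y) ≡ ceilSqrt x
  s≡c = ∸-cancelʳ-≡ (1<l+h∸w⊓y w<l y<h) (1<ceilSqrt 1<x) tight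

  1<mc : 1 < m * ceilSqrt x
  1<mc = *-mono-≤ 1≤m (1<ceilSqrt 1<x)

  1<cₘ : 1 < ceilSqrt ((m * m) * x)
  1<cₘ = 1<ceilSqrt (*-mono-≤ (*-mono-≤ 1≤m 1≤m) 1<x)

  -- Tightness of the original shape enters here, turning the scaled diameter into a multiple of the
  -- ceiling.
  diamₘ : diam (m * l) (m * h) (m * w) (m * y) ≡ m * ceilSqrt x ∸ 2
  diamₘ = trans (diam-scale m l h w y) (cong (λ r → m * r ∸ 2) s≡c)

  lbₘ : lb (area (m * l) (m * h) (m * w) (m * y)) ≡ ceilSqrt ((m * m) * x) ∸ 2
  lbₘ = cong (λ n → ceilSqrt n ∸ 2) (trans (cong (3 *_) (area-scale m l h w y))
    (x∙yz≈y∙xz 3 (m * m) (area l h w y)))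
    where open import Algebra.Properties.CommutativeSemigroup *-commutativeSemigroup using (x∙yz≈y∙xz)
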